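{- Let $G$ be a finite group and let $Max_G=\{x_1,\dots,x_m\}$ be an essential cyclic set of $G$ with $m\geq 3$. If $icn(G)=1$, then $rc(\Gamma_G^e)=3$ if and only if $G$ does not have an awning.
   Context: Let $G$ be a finite group with identity $e$. The enhanced power graph $\Gamma_G^e$ has vertex set $G$, two distinct vertices $x,y$ being adjacent iff $x,y\in\langle z\rangle$ for some $z\in G$. For a connected graph $\Gamma$, an edge-colouring $\zeta:E(\Gamma)\to\{1,\dots,k\}$ (not necessarily proper) is a rainbow $k$-colouring if every pair of distinct vertices is joined by a path whose edges have pairwise distinct colours; $rc(\Gamma)$ is the minimum such $k$. An essential cyclic set $Max_G=\{x_1,\dots,x_m\}$ is a set of elements of $G$ such that $\langle x_1\rangle,\dots,\langle x_m\rangle$ are pairwise distinct and are exactly the maximal cyclic subgroups of $G$. The independence cyclic set is $ics(G)=\{x_i\in Max_G:\langle x_i\rangle\cap\langle x_j\rangle=\{e\}\text{ for all }j\neq i\}$ and $icn(G)=|ics(G)|$. Awning: given an ordering $x_1,\dots,x_m$ of $Max_G$, an awning is a family of indexed sets $H_1,\dots,H_{m-1}$, where $H_i=\{h_{i,i+1},\dots,h_{i,m}\}\subseteq\langle x_i\rangle$ is partitioned as $H_i=A_i\,\dot\cup\,B_i$, such that (1) $h_{i,j}\in\langle x_i\rangle\cap\langle x_j\rangle$ for all $i<j$; (2) whenever $i<j$, $2\le j\le m-1$, $s\in\{j+1,\dots,m\}$, $r\in\{i+1,\dots,m\}$ and $h_{j,s}=h_{i,r}$: (a) if $r=j$ and $h_{i,r}\in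 A_i$ then $h_{j,s}\in B_j$; (b) if $r=j$ and $h_{i,r}\in B_i$ then $h_{j,s}\in A_j$; (c) if $r=s>j$ and $h_{i,r}\in A_i$ then $h_{j,r}\in A_j$; (d) if $r=s>j$ and $h_{i,r}\in B_i$ then $h_{j,r}\in B_j$. $G$ has an awning if an awning exists for some ordering of $Max_G$. -}

module Defs where

open import Level using (0ℓ)
open import Data.Nat using (ℕ; zero; suc)
open import Data.Fin using (Fin; inject₁; fromℕ) renaming (zero to fzero; suc to fsuc; _<_ to _<ᶠ_)
open import Data.Fin.Permutation using (Permutation′; _⟨$⟩ʳ_)
open import Data.Bool using (Bool; true; false)
open import Data.Product using (Σ; ∃; _×_; _,_)
open import Function.Definitions using (Injective)
open import Relation.Nullary using (¬_)
open import Relation.Binary.PropositionalEquality using (_≡_; _≢_)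
open import Algebra.Structures using (IsGroup)

-- Finite groups: a group structure (with propositional equality) on the
-- finite set Fin order.  Every finite group is isomorphic to one of these.

record FiniteGroup : Set where
  field
    order   : ℕ
    _∙_     : Fin order → Fin order → Fin order
    e       : Fin order
    _⁻¹     : Fin order → Fin order
    isGroup : IsGroup _≡_ _∙_ e _⁻¹

  Carrier : Set
  Carrier = Fin order

  _^_ : Carrier → ℕ → Carrier
  z ^ zero  = e
  z ^ suc k = z ∙ (z ^ k)

  -- membership in the cyclic subgroup ⟨z⟩ = { z^k | k ∈ ℕ }  (G finite)
  _∈⟨_⟩ : Carrier → Carrier → Set
  x ∈⟨ z ⟩ = ∃ λ k → z ^ k ≡ x

  _⊆⟨⟩_ : Carrier → Carrier → Set
  x ⊆⟨⟩ z = ∀ g → g ∈⟨ x ⟩ → g ∈⟨ z ⟩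

  _≐⟨⟩_ : Carrier → Carrier → Set
  x ≐⟨⟩ z = (x ⊆⟨⟩ z) × (z ⊆⟨⟩ x)

  MaximalCyclic : Carrier → Set
  MaximalCyclic x = ∀ z → x ⊆⟨⟩ z → z ⊆⟨⟩ x

  record EssentialCyclicSet (m : ℕ) (xs : Fin m → Carrier) : Set where
    field
      maximal  : ∀ i → MaximalCyclic (xs i)
      distinct : ∀ i j → i ≢ j → ¬ (xs i ≐⟨⟩ xs j)
      covers   : ∀ z → MaximalCyclic z → ∃ λ i → z ≐⟨⟩ xs i

  InICS : {m : ℕ} → (Fin m → Carrier) → Fin m → Set
  InICS xs i = ∀ j → j ≢ i → ∀ g → g ∈⟨ xs i ⟩ → g ∈⟨ xs j ⟩ → g ≡ e

  ICN≡1 : {m : ℕ} → (Fin m → Carrier) → Set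
  ICN≡1 xs = ∃ λ i → InICS xs i × (∀ j → InICS xs j → j ≡ i)

  -- Awning for the ordering y_1,…,y_m of Max_G (indices 0-based here).
  -- h i j  is h_{i,j} (only used for i < j);  H_i = {h_{i,j} | j > i}.
  -- inA i g ≡ true  means g ∈ A_i, and for g ∈ H_i,  inA i g ≡ false
  -- means g ∈ B_i = H_i ∖ A_i  (so H_i = A_i ∪̇ B_i).
  record Awning {m : ℕ} (ys : Fin m → Carrier)
                (h : Fin m → Fin m → Carrier) (inA : Fin m → Carrier → Bool) : Set where
    field
      cond1  : ∀ i j → i <ᶠ j → (h i j ∈⟨ ys i ⟩) × (h i j ∈⟨ ys j ⟩)
      cond2a : ∀ i j s r → i <ᶠ j → j <ᶠ s → i <ᶠ r → h j s ≡ h i r →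
               r ≡ j → inA i (h i r) ≡ true → inA j (h j s) ≡ false
      cond2b : ∀ i j s r → i <ᶠ j → j <ᶠ s → i <ᶠ r → h j s ≡ h i r →
               r ≡ j → inA i (h i r) ≡ false → inA j (h j s) ≡ true
      cond2c : ∀ i j s r → i <ᶠ j → j <ᶠ s → i <ᶠ r → h j s ≡ h i r →
               r ≡ s → inA i (h i r) ≡ true → inA j (h j r) ≡ true
      cond2d : ∀ i j s r → i <ᶠ j → j <ᶠ s → i <ᶠ r → h j s ≡ h i r →
               r ≡ s → inA i (h i r) ≡ false → inA j (h j r) ≡ false

  HasAwning : {m : ℕ} → (Fin m → Carrier) → Set
  HasAwning {m} xs = Σ (Permutation′ m) λ σ →
    ∃ λ h → ∃ λ inA → Awning (λ i → xs (σ ⟨$⟩ʳ i)) h inA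

  EPAdj : Carrier → Carrier → Set
  EPAdj x y = x ≢ y × ∃ λ z → x ∈⟨ z ⟩ × y ∈⟨ z ⟩

-- Rainbow connection for a graph on vertex set V with adjacency Adj.
-- An edge colouring with colours Fin k is a symmetric function on pairs
-- (only its values on edges matter).

module _ {V : Set} (Adj : V → V → Set) where

  record EdgeColouring (k : ℕ) : Set where
    field
      col  : V → V → Fin k
      symm : ∀ x y → col x y ≡ col y x

  record RainbowPath {k : ℕ} (ζ : EdgeColouring k) (x y : V) : Set where
    open EdgeColouring ζ
    field
      len      : ℕ
      v        : Fin (suc len) → V
      start    : v fzero ≡ x
      end      : v (fromℕ len) ≡ y
      distinct : Injective _≡_ _≡_ v
      adjacent : ∀ (i : Fin len) → Adj (v (inject₁ i)) (v (fsuc i))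
      rainbow  : Injective _≡_ _≡_ (λ (i : Fin len) → col (v (inject₁ i)) (v (fsuc i)))

  IsRainbowColouring : {k : ℕ} → EdgeColouring k → Set
  IsRainbowColouring ζ = ∀ x y → x ≢ y → RainbowPath ζ x y

  RainbowColourable : ℕ → Set
  RainbowColourable k = Σ (EdgeColouring k) IsRainbowColouring

  RC≡ : ℕ → Set
  RC≡ k = RainbowColourable k × (∀ j → j Data.Nat.< k → ¬ RainbowColourable j)

{-# OPTIONS --safe #-}

-- Both sides of the equivalence hold outright.
--
-- Let ⟨a⟩ be the independent maximal cyclic subgroup, and suppose that the other maximal cyclic
-- subgroups met pairwise nontrivially.  For maximal ⟨b⟩ ≠ ⟨a⟩, common elements of ⟨b⟩ with its
-- conjugates and with conjugates of ⟨a⟩ yield w ≠ e in ⟨b⟩ commuting with a.  The order n of a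
-- divides the order of every nontrivial element of ⟨b⟩ commuting with a, so w has a power u of
-- order n.  Let ⟨c⟩ be maximal containing a u.  A nontrivial element of ⟨b⟩ ∩ ⟨c⟩ commutes with
-- u and a u, hence with a, and has a nontrivial power in both ⟨u⟩ and ⟨a u⟩; but (a u)^q ∈ ⟨u⟩
-- gives a^q = e, hence u^q = e, a contradiction.
--
-- On the other hand, both an awning and a rainbow colouring with fewer than three colours would
-- make these subgroups meet pairwise nontrivially: e is their only common element with ⟨a⟩, which
-- uses up both values of the awning (both colours) at e.
--
-- A rainbow 3-colouring: an edge e–x gets colour 0 if x ∈ ⟨a⟩ and otherwise 1 or 2 according to
-- whether x < x⁻¹, so that every x ∉ ⟨a⟩ has a neighbour x' ∉ ⟨a⟩ of the opposite class; all
-- edges avoiding e get colour 0.  Elements x, y ∉ ⟨a⟩ of the same class are joined by x–x'–e–y.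

module Submission where

open import Defs
open import Algebra.Bundles using (Group)
import Algebra.Properties.Group as GroupProperties
import Algebra.Properties.Monoid.Mult as Multiplication
open import Data.Bool using (true; false)
open import Data.Empty using (⊥)
open import Data.Fin using (Fin; toℕ; fromℕ; fromℕ<)
  renaming (zero to fzero; suc to fsuc; _<_ to _<ᶠ_)
open import Data.Fin.Induction using (spo-noetherian)
open import Data.Fin.Patterns using (0F; 1F; 2F)
open import Data.Fin.Permutation using (_⟨$⟩ʳ_; _⟨$⟩ˡ_; inverseʳ) renaming (inverseˡ to inverseˡ-perm)
open import Data.Fin.Properties
  using (_≟_; _<?_; any?; toℕ-fromℕ; pigeonhole; injective⇒≤; ¬∀⟶∃¬-smallest; toℕ-fromℕ<; toℕ-inject)
  renaming (<-cmp to <ᶠ-cmp; <-asym to <ᶠ-asym; <-trans to <ᶠ-trans)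
open import Data.Nat using (ℕ; zero; suc; _+_; _*_; _∸_; _≤_; _<_; _%_; _/_; NonZero; z≤n; s≤s; ≢-nonZero)
open import Data.Nat.DivMod using (m≡m%n+[m/n]*n; m%n<n)
open import Data.Nat.Divisibility using (_∣_; divides; m%n≡0⇒n∣m)
open import Data.Nat.GCD using (module Bézout; module GCD)
open import Data.Nat.Properties
  using (*-comm; *-assoc; *-cancelʳ-≡; *-identityˡ; m∸n+n≡m; m<n⇒0<n∸m; <⇒≤; <⇒≱; ≤-trans; n<1+n; suc-injective; m*n≡1⇒n≡1)
open import Data.Product using (∃; _×_; _,_; proj₁; proj₂; swap)
open import Data.Sum using (_⊎_; inj₁; inj₂)
open import Data.Vec using (lookup; tabulate; []; _∷_)
open import Data.Vec.Properties using (lookup∘tabulate)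
open import Data.Vec.Relation.Unary.All using ([]; _∷_)
open import Data.Vec.Relation.Unary.AllPairs using ([]; _∷_)
open import Data.Vec.Relation.Unary.Unique.Propositional using (Unique)
open import Data.Vec.Relation.Unary.Unique.Propositional.Properties using (lookup-injective)
open import Function using (_∘_; flip)
open import Function.Bundles using (_⇔_; mk⇔)
open import Function.Definitions using (Injective)
open import Induction.WellFounded using (WellFounded; Acc; acc)
open import Relation.Binary.Definitions using (Tri; tri<; tri≈; tri>)
open import Relation.Binary.PropositionalEquality
open import Relation.Nullary using (¬_; Dec; yes; no; contradiction)
open import Relation.Nullary.Decidable using (map′; ¬?; _×-dec_; decidable-stable)

-- Turns injectivity of an explicitly listed function into a table of pairwise inequalities, the
-- form in which the paths below certify distinct vertices and distinct colours.
Unique-tabulate⇒injective : ∀ {A : Set} {n} (f : Fin n → A) → Unique (tabulate f) → Injective _≡_ _≡_ f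
Unique-tabulate⇒injective f unique {i} {j} fi≡fj = lookup-injective unique i j
  (trans (lookup∘tabulate f i) (trans fi≡fj (sym (lookup∘tabulate f j))))

distinct-triple⇒3≤ : ∀ {k} {c₀ c₁ c₂ : Fin k} → c₀ ≢ c₁ → c₀ ≢ c₂ → c₁ ≢ c₂ → 3 ≤ k
distinct-triple⇒3≤ {c₀ = c₀} {c₁} {c₂} c₀≢c₁ c₀≢c₂ c₁≢c₂ =
  injective⇒≤ (Unique-tabulate⇒injective (lookup (c₀ ∷ c₁ ∷ c₂ ∷ []))
    ((c₀≢c₁ ∷ c₀≢c₂ ∷ []) ∷ (c₁≢c₂ ∷ []) ∷ [] ∷ []))

-- Short rainbow paths

module RainbowPaths {V : Set} {Adj : V → V → Set} {k} (ζ : EdgeColouring Adj k) where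

  open EdgeColouring ζ

  path₁ : ∀ {x y} → x ≢ y → Adj x y → RainbowPath Adj ζ x y
  path₁ {x} {y} x≢y xy = record
    { len      = 1
    ; v        = lookup (x ∷ y ∷ [])
    ; start    = refl
    ; end      = refl
    ; distinct = Unique-tabulate⇒injective _ ((x≢y ∷ []) ∷ [] ∷ [])
    ; adjacent = λ { 0F → xy }
    ; rainbow  = Unique-tabulate⇒injective _ ([] ∷ [])
    }

  path₂ : ∀ {x p y} → x ≢ p → x ≢ y → p ≢ y → Adj x p → Adj p y → col x p ≢ col p y →
          RainbowPath Adj ζ x y
  path₂ {x} {p} {y} x≢p x≢y p≢y xp py c≢ = record
    { len      = 2
    ; v        = lookup (x ∷ p ∷ y ∷ [])
    ; start    = refl
    ; end      = refl
    ; distinct = Unique-tabulate⇒injective _ ((x≢p ∷ x≢y ∷ []) ∷ (p≢y ∷ []) ∷ [] ∷ [])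
    ; adjacent = λ { 0F → xp ; 1F → py }
    ; rainbow  = Unique-tabulate⇒injective _ ((c≢ ∷ []) ∷ [] ∷ [])
    }

  path₃ : ∀ {x p q y} → x ≢ p → x ≢ q → x ≢ y → p ≢ q → p ≢ y → q ≢ y →
          Adj x p → Adj p q → Adj q y →
          col x p ≢ col p q → col x p ≢ col q y → col p q ≢ col q y →
          RainbowPath Adj ζ x y
  path₃ {x} {p} {q} {y} x≢p x≢q x≢y p≢q p≢y q≢y xp pq qy c₀₁ c₀₂ c₁₂ = record
    { len      = 3
    ; v        = lookup (x ∷ p ∷ q ∷ y ∷ [])
    ; start    = refl
    ; end      = refl
    ; distinct = Unique-tabulate⇒injective _
                   ((x≢p ∷ x≢q ∷ x≢y ∷ []) ∷ (p≢q ∷ p≢y ∷ []) ∷ (q≢y ∷ []) ∷ [] ∷ [])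
    ; adjacent = λ { 0F → xp ; 1F → pq ; 2F → qy }
    ; rainbow  = Unique-tabulate⇒injective _ ((c₀₁ ∷ c₀₂ ∷ []) ∷ (c₁₂ ∷ []) ∷ [] ∷ [])
    }

  -- Three or more edges would need three colours, while lengths 0 and 1 contradict x ≠ y and
  -- non-adjacency; only length 2 remains.
  rainbow-midpoint : k < 3 → ∀ {x y} → x ≢ y → ¬ Adj x y → RainbowPath Adj ζ x y →
                     ∃ λ p → Adj x p × Adj p y × col x p ≢ col p y
  rainbow-midpoint k<3 x≢y ¬xy record { len = 0 ; start = refl ; end = refl } =
    contradiction refl x≢y
  rainbow-midpoint k<3 x≢y ¬xy record { len = 1 ; start = refl ; end = refl ; adjacent = adjacent } =
    contradiction (adjacent 0F) ¬xy
  rainbow-midpoint k<3 x≢y ¬xy record { len = 2 ; v = v ; start = refl ; end = refl ; adjacent = adjacent ; rainbow = rainbow } =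
    v 1F , adjacent 0F , adjacent 1F , λ c≡ → contradiction (rainbow {0F} {1F} c≡) λ ()
  rainbow-midpoint k<3 x≢y ¬xy record { len = suc (suc (suc _)) ; rainbow = rainbow } =
    contradiction (≤-trans (s≤s (s≤s (s≤s z≤n))) (injective⇒≤ rainbow)) (<⇒≱ k<3)

module CyclicSubgroups (G : FiniteGroup) where

  open FiniteGroup G hiding (_∙_; _⁻¹)
    renaming (_^_ to infixr 9 _^_; _∈⟨_⟩ to infix 4 _∈⟨_⟩; _⊆⟨⟩_ to infix 4 _⊆⟨⟩_; _≐⟨⟩_ to infix 4 _≐⟨⟩_)

  𝔾 : Group _ _
  𝔾 = record { isGroup = isGroup }

  open Group 𝔾 using (_∙_; _⁻¹; assoc; identityˡ; identityʳ; inverseˡ; monoid)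
    renaming (inverseʳ to ∙-inverseʳ)
  open GroupProperties 𝔾
  open Multiplication monoid using (×-homo-+; ×-assocˡ) renaming (_×_ to _·_)
  open ≡-Reasoning

  -- Powers in a group

  ^≡· : ∀ z k → z ^ k ≡ k · z
  ^≡· z zero    = refl
  ^≡· z (suc k) = cong (z ∙_) (^≡· z k)

  ^-+ : ∀ z m n → z ^ (m + n) ≡ z ^ m ∙ z ^ n
  ^-+ z m n = begin
    z ^ (m + n)      ≡⟨ ^≡· z (m + n) ⟩
    (m + n) · z      ≡⟨ ×-homo-+ z m n ⟩
    m · z ∙ n · z    ≡⟨ cong₂ _∙_ (^≡· z m) (^≡· z n) ⟨
    z ^ m ∙ z ^ n    ∎

  ^-* : ∀ z m n → z ^ (m * n) ≡ (z ^ n) ^ m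
  ^-* z m n = begin
    z ^ (m * n)      ≡⟨ ^≡· z (m * n) ⟩
    (m * n) · z      ≡⟨ ×-assocˡ z m n ⟨
    m · (n · z)      ≡⟨ cong (m ·_) (^≡· z n) ⟨
    m · (z ^ n)      ≡⟨ ^≡· (z ^ n) m ⟨
    (z ^ n) ^ m      ∎

  e^ : ∀ k → e ^ k ≡ e
  e^ zero    = refl
  e^ (suc k) = trans (identityˡ _) (e^ k)

  ^-*≡e : ∀ z m {n} → z ^ n ≡ e → z ^ (m * n) ≡ e
  ^-*≡e z m {n} zⁿ≡e = trans (^-* z m n) (trans (cong (_^ m) zⁿ≡e) (e^ m))

  ^-% : ∀ z {n} .{{_ : NonZero n}} → z ^ n ≡ e → ∀ k → z ^ (k % n) ≡ z ^ k
  ^-% z {n} zⁿ≡e k = begin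
    z ^ (k % n)                      ≡⟨ identityʳ _ ⟨
    z ^ (k % n) ∙ e                  ≡⟨ cong (z ^ (k % n) ∙_) (^-*≡e z (k / n) zⁿ≡e) ⟨
    z ^ (k % n) ∙ z ^ (k / n * n)    ≡⟨ ^-+ z (k % n) (k / n * n) ⟨
    z ^ (k % n + k / n * n)          ≡⟨ cong (z ^_) (m≡m%n+[m/n]*n k n) ⟨
    z ^ k                            ∎

  -- Commuting elements

  Commute : Carrier → Carrier → Set
  Commute g h = g ∙ h ≡ h ∙ g

  commute-∙ : ∀ {g h k} → Commute g h → Commute g k → Commute g (h ∙ k)
  commute-∙ {g} {h} {k} gh gk = begin
    g ∙ (h ∙ k)    ≡⟨ assoc g h k ⟨
    (g ∙ h) ∙ k    ≡⟨ cong (_∙ k) gh ⟩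
    (h ∙ g) ∙ k    ≡⟨ assoc h g k ⟩
    h ∙ (g ∙ k)    ≡⟨ cong (h ∙_) gk ⟩
    h ∙ (k ∙ g)    ≡⟨ assoc h k g ⟨
    (h ∙ k) ∙ g    ∎

  commute-cancelˡ : ∀ {g h k} → Commute g h → Commute g (h ∙ k) → Commute g k
  commute-cancelˡ {g} {h} {k} gh ghk = ∙-cancelˡ h _ _ (begin
    h ∙ (g ∙ k)    ≡⟨ assoc h g k ⟨
    (h ∙ g) ∙ k    ≡⟨ cong (_∙ k) gh ⟨
    (g ∙ h) ∙ k    ≡⟨ assoc g h k ⟩
    g ∙ (h ∙ k)    ≡⟨ ghk ⟩
    (h ∙ k) ∙ g    ≡⟨ assoc h k g ⟩
    h ∙ (k ∙ g)    ∎)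

  commute-^ : ∀ {g h} → Commute g h → ∀ k → Commute g (h ^ k)
  commute-^ gh zero    = trans (identityʳ _) (sym (identityˡ _))
  commute-^ gh (suc k) = commute-∙ gh (commute-^ gh k)

  commute-∈ : ∀ {g h x} → Commute g h → x ∈⟨ h ⟩ → Commute g x
  commute-∈ gh (k , refl) = commute-^ gh k

  ∈-commute : ∀ {x y z} → x ∈⟨ z ⟩ → y ∈⟨ z ⟩ → Commute x y
  ∈-commute x∈z y∈z = commute-∈ (sym (commute-∈ refl x∈z)) y∈z

  ∙-^ : ∀ {g h} → Commute g h → ∀ k → (g ∙ h) ^ k ≡ g ^ k ∙ h ^ k
  ∙-^         gh zero    = sym (identityˡ e)
  ∙-^ {g} {h} gh (suc k) = begin
    (g ∙ h) ∙ (g ∙ h) ^ k        ≡⟨ cong ((g ∙ h) ∙_) (∙-^ gh k) ⟩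
    (g ∙ h) ∙ (g ^ k ∙ h ^ k)    ≡⟨ assoc g h _ ⟩
    g ∙ (h ∙ (g ^ k ∙ h ^ k))    ≡⟨ cong (g ∙_) (assoc h _ _) ⟨
    g ∙ ((h ∙ g ^ k) ∙ h ^ k)    ≡⟨ cong (λ x → g ∙ (x ∙ h ^ k)) (commute-^ (sym gh) k) ⟩
    g ∙ ((g ^ k ∙ h) ∙ h ^ k)    ≡⟨ cong (g ∙_) (assoc _ h _) ⟩
    g ∙ (g ^ k ∙ (h ∙ h ^ k))    ≡⟨ assoc g _ _ ⟨
    (g ∙ g ^ k) ∙ (h ∙ h ^ k)    ∎

  -- Orders of elements

  record Order (z : Carrier) : Set where
    field
      n-1       : ℕ
      ^-order   : z ^ suc n-1 ≡ e
      order-∣   : ∀ k → z ^ k ≡ e → suc n-1 ∣ k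

  -- The pigeonhole principle gives zⁱ = zʲ with i < j, so j - i is a positive exponent killing z;
  -- the order is the least such exponent.
  orderOf : ∀ z → Order z
  orderOf z with pigeonhole (n<1+n order) (λ i → z ^ toℕ i)
  ... | i , j , i<j , zⁱ≡zʲ
      with toℕ j ∸ toℕ i in eq | m<n⇒0<n∸m i<j
  ... | suc p | _
      -- Index k stands for the exponent k + 1, so that only positive exponents are searched.
      with ¬∀⟶∃¬-smallest (suc p) (λ k → z ^ suc (toℕ k) ≢ e) (λ k → ¬? (z ^ suc (toℕ k) ≟ e))
             (λ never → never (fromℕ p) (trans (cong (λ t → z ^ suc t) (toℕ-fromℕ p)) zᵖ≡e))
    where
      zᵖ≡e : z ^ suc p ≡ e
      zᵖ≡e = identityˡ-unique (z ^ suc p) (z ^ toℕ i) (begin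
        z ^ suc p ∙ z ^ toℕ i            ≡⟨ ^-+ z (suc p) (toℕ i) ⟨
        z ^ (suc p + toℕ i)              ≡⟨ cong (λ t → z ^ (t + toℕ i)) eq ⟨
        z ^ (toℕ j ∸ toℕ i + toℕ i)      ≡⟨ cong (z ^_) (m∸n+n≡m (<⇒≤ i<j)) ⟩
        z ^ toℕ j                        ≡⟨ zⁱ≡zʲ ⟨
        z ^ toℕ i                        ∎)
  ... | k , ¬zᵏ≢e , minimal = record
    { n-1     = toℕ k
    ; ^-order = zᴺ≡e
    -- The remainder of l modulo N also kills z and is below N, so minimality makes it 0.
    ; order-∣ = λ l zˡ≡e → m%n≡0⇒n∣m l N (remainder≡0 (l % N) (m%n<n l N) (trans (^-% z zᴺ≡e l) zˡ≡e))
    }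
    where
      N = suc (toℕ k)
      zᴺ≡e = decidable-stable (z ^ N ≟ e) ¬zᵏ≢e
      remainder≡0 : ∀ r → r < N → z ^ r ≡ e → r ≡ 0
      remainder≡0 zero    _         _    = refl
      remainder≡0 (suc r) (s≤s r<k) zʳ≡e =
        contradiction (trans (cong (λ t → z ^ suc t) (trans (toℕ-inject _) (toℕ-fromℕ< r<k))) zʳ≡e)
                      (minimal (fromℕ< r<k))

  -- Cyclic subgroups and maximality

  e∈ : ∀ {z} → e ∈⟨ z ⟩
  e∈ = 0 , refl

  ∈-refl : ∀ {z} → z ∈⟨ z ⟩
  ∈-refl = 1 , identityʳ _

  ∈-^ : ∀ {x z} k → x ∈⟨ z ⟩ → x ^ k ∈⟨ z ⟩
  ∈-^ {z = z} k (l , refl) = k * l , ^-* z k l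

  ∈-trans : ∀ {x y z} → x ∈⟨ y ⟩ → y ∈⟨ z ⟩ → x ∈⟨ z ⟩
  ∈-trans (k , refl) = ∈-^ k

  ∈-∙ : ∀ {x y z} → x ∈⟨ z ⟩ → y ∈⟨ z ⟩ → x ∙ y ∈⟨ z ⟩
  ∈-∙ {z = z} (k , refl) (l , refl) = k + l , ^-+ z k l

  ⁻¹∈ : ∀ {z} → z ⁻¹ ∈⟨ z ⟩
  ⁻¹∈ {z} = n-1 , inverseʳ-unique z _ ^-order
    where open Order (orderOf z)

  ∈-⁻¹ : ∀ {x z} → x ∈⟨ z ⟩ → x ⁻¹ ∈⟨ z ⟩
  ∈-⁻¹ = ∈-trans ⁻¹∈

  ∈-⁻¹⁻ : ∀ {x z} → x ⁻¹ ∈⟨ z ⟩ → x ∈⟨ z ⟩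
  ∈-⁻¹⁻ {z = z} x⁻¹∈z = subst (_∈⟨ z ⟩) (⁻¹-involutive _) (∈-⁻¹ x⁻¹∈z)

  ∈-cancelˡ : ∀ {x y z} → x ∈⟨ z ⟩ → x ∙ y ∈⟨ z ⟩ → y ∈⟨ z ⟩
  ∈-cancelˡ {x} {y} {z} x∈z xy∈z = subst (_∈⟨ z ⟩) (\\-leftDividesʳ x y) (∈-∙ (∈-⁻¹ x∈z) xy∈z)

  ∈-cancelʳ : ∀ {x y z} → y ∈⟨ z ⟩ → x ∙ y ∈⟨ z ⟩ → x ∈⟨ z ⟩
  ∈-cancelʳ {x} {y} {z} y∈z xy∈z = subst (_∈⟨ z ⟩) (//-rightDividesʳ y x) (∈-∙ xy∈z (∈-⁻¹ y∈z))

  ∈⇒⊆ : ∀ {x z} → x ∈⟨ z ⟩ → x ⊆⟨⟩ z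
  ∈⇒⊆ x∈z g g∈x = ∈-trans g∈x x∈z

  ⊆⇒∈ : ∀ {x z} → x ⊆⟨⟩ z → x ∈⟨ z ⟩
  ⊆⇒∈ x⊆z = x⊆z _ ∈-refl

  maximal-∈ : ∀ {c z} → MaximalCyclic c → c ∈⟨ z ⟩ → z ∈⟨ c ⟩
  maximal-∈ c-max c∈z = ⊆⇒∈ (c-max _ (∈⇒⊆ c∈z))

  infix 4 _∈?⟨_⟩
  -- Exponents may be reduced modulo the order of z, which leaves a finite search.
  _∈?⟨_⟩ : ∀ x z → Dec (x ∈⟨ z ⟩)
  x ∈?⟨ z ⟩ = map′ (λ (i , zⁱ≡x) → toℕ i , zⁱ≡x) reduce (any? λ (i : Fin N) → z ^ toℕ i ≟ x)
    where
      open Order (orderOf z)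
      N = suc n-1
      reduce : x ∈⟨ z ⟩ → ∃ λ (i : Fin N) → z ^ toℕ i ≡ x
      reduce (k , refl) = fromℕ< (m%n<n k N) , 
        trans (cong (z ^_) (toℕ-fromℕ< (m%n<n k N))) (^-% z ^-order k)

  infix 4 _⊏_
  _⊏_ : Carrier → Carrier → Set
  x ⊏ y = x ∈⟨ y ⟩ × ¬ (y ∈⟨ x ⟩)

  ⊐-wellFounded : WellFounded (flip _⊏_)
  ⊐-wellFounded = spo-noetherian {_≈_ = _≡_} record
    { isEquivalence = isEquivalence
    ; irrefl        = λ { refl (_ , x∉x) → x∉x ∈-refl }
    ; trans         = λ (x∈y , y∉x) (y∈z , z∉y) → ∈-trans x∈y y∈z , λ z∈x → y∉x (∈-trans y∈z z∈x)
    ; <-resp-≈      = (λ { refl p → p }) , (λ { refl p → p })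
    }

  -- Passing to a strictly larger cyclic subgroup while one exists must stop, by `⊐-wellFounded`.
  maximalCyclic-above : ∀ z → ∃ λ c → MaximalCyclic c × z ∈⟨ c ⟩
  maximalCyclic-above z = go z (⊐-wellFounded z)
    where
      go : ∀ z → Acc (flip _⊏_) z → ∃ λ c → MaximalCyclic c × z ∈⟨ c ⟩
      go z (acc larger) with any? (λ y → (z ∈?⟨ y ⟩) ×-dec ¬? (y ∈?⟨ z ⟩))
      ... | no none = z , (λ y z⊆y → ∈⇒⊆ (decidable-stable (y ∈?⟨ z ⟩) λ y∉z → none (y , ⊆⇒∈ z⊆y , y∉z))) , ∈-refl
      ... | yes (y , z⊏y) with go y (larger z⊏y)
      ...   | c , c-max , y∈c = c , c-max , ∈-trans (proj₁ z⊏y) y∈c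

  -- Conjugation

  conj : Carrier → Carrier → Carrier
  conj g z = (g ∙ z) ∙ g ⁻¹

  conj-∙ : ∀ g y z → conj g y ∙ conj g z ≡ conj g (y ∙ z)
  conj-∙ g y z = begin
    conj g y ∙ ((g ∙ z) ∙ g ⁻¹)      ≡⟨ assoc _ _ _ ⟨
    (conj g y ∙ (g ∙ z)) ∙ g ⁻¹      ≡⟨ cong (_∙ g ⁻¹) (assoc _ g z) ⟨
    ((conj g y ∙ g) ∙ z) ∙ g ⁻¹      ≡⟨ cong (λ x → (x ∙ z) ∙ g ⁻¹) (//-rightDividesˡ g (g ∙ y)) ⟩
    ((g ∙ y) ∙ z) ∙ g ⁻¹             ≡⟨ cong (_∙ g ⁻¹) (assoc g y z) ⟩
    conj g (y ∙ z)                   ∎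

  commute⇒conj≡ : ∀ {g z} → Commute g z → conj g z ≡ z
  commute⇒conj≡ {g} {z} gz = trans (cong (_∙ g ⁻¹) gz) (//-rightDividesʳ g z)

  conj≡⇒commute : ∀ {g z} → conj g z ≡ z → Commute g z
  conj≡⇒commute {g} {z} eq = trans (sym (//-rightDividesˡ g (g ∙ z))) (cong (_∙ g) eq)

  conj-^ : ∀ g z k → conj g z ^ k ≡ conj g (z ^ k)
  conj-^ g z zero    = sym (trans (cong (_∙ g ⁻¹) (identityʳ g)) (∙-inverseʳ g))
  conj-^ g z (suc k) = trans (cong (conj g z ∙_) (conj-^ g z k)) (conj-∙ g z (z ^ k))

  conj-∈ : ∀ g {x z} → x ∈⟨ z ⟩ → conj g x ∈⟨ conj g z ⟩
  conj-∈ g {z = z} (k , refl) = k , conj-^ g z k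

  conj-⁻¹-conj : ∀ g z → conj (g ⁻¹) (conj g z) ≡ z
  conj-⁻¹-conj g z = begin
    (g ⁻¹ ∙ ((g ∙ z) ∙ g ⁻¹)) ∙ g ⁻¹ ⁻¹   ≡⟨ cong (λ x → (g ⁻¹ ∙ x) ∙ g ⁻¹ ⁻¹) (assoc g z _) ⟩
    (g ⁻¹ ∙ (g ∙ (z ∙ g ⁻¹))) ∙ g ⁻¹ ⁻¹   ≡⟨ cong (_∙ g ⁻¹ ⁻¹) (\\-leftDividesʳ g _) ⟩
    (z ∙ g ⁻¹) ∙ g ⁻¹ ⁻¹                  ≡⟨ //-rightDividesʳ (g ⁻¹) z ⟩
    z                                     ∎

  conj-conj-⁻¹ : ∀ g z → conj g (conj (g ⁻¹) z) ≡ z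
  conj-conj-⁻¹ g z = trans (cong (λ h → conj h (conj (g ⁻¹) z)) (sym (⁻¹-involutive g))) (conj-⁻¹-conj (g ⁻¹) z)

  conj-∈⁻ : ∀ g {x z} → conj g x ∈⟨ z ⟩ → x ∈⟨ conj (g ⁻¹) z ⟩
  conj-∈⁻ g {x} {z} gx∈z = subst (_∈⟨ conj (g ⁻¹) z ⟩) (conj-⁻¹-conj g x) (conj-∈ (g ⁻¹) gx∈z)

  conj-maximal : ∀ g {c} → MaximalCyclic c → MaximalCyclic (conj g c)
  conj-maximal g {c} c-max z gc⊆z = ∈⇒⊆ (subst (_∈⟨ conj g c ⟩) (conj-conj-⁻¹ g z)
    (conj-∈ g (maximal-∈ c-max (conj-∈⁻ g (⊆⇒∈ gc⊆z)))))

  -- An independent maximal cyclic subgroup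

  module IndependentCyclic
    {a : Carrier} (a-max : MaximalCyclic a)
    (indep-max : ∀ {c} → MaximalCyclic c → ¬ (c ∈⟨ a ⟩) → ∀ {g} → g ∈⟨ a ⟩ → g ∈⟨ c ⟩ → g ≡ e)
    where

    -- A maximal cyclic ⟨d⟩ above c is not inside ⟨a⟩, since it contains c; so independence, assumed
    -- for maximal subgroups, passes down to ⟨c⟩.
    indep : ∀ {c} → ¬ (c ∈⟨ a ⟩) → ∀ {g} → g ∈⟨ a ⟩ → g ∈⟨ c ⟩ → g ≡ e
    indep {c} c∉a g∈a g∈c with maximalCyclic-above c
    ... | d , d-max , c∈d = indep-max d-max (λ d∈a → c∉a (∈-trans c∈d d∈a)) g∈a (∈-trans g∈c c∈d)

    ∉⟨a⟩ : ∀ {c g} → ¬ (c ∈⟨ a ⟩) → g ∈⟨ c ⟩ → g ≢ e → ¬ (g ∈⟨ a ⟩)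
    ∉⟨a⟩ c∉a g∈c g≢e g∈a = g≢e (indep c∉a g∈a g∈c)

    a∙-∉ : ∀ {u} → ¬ (u ∈⟨ a ⟩) → ¬ (a ∙ u ∈⟨ a ⟩)
    a∙-∉ u∉a au∈a = u∉a (∈-cancelˡ ∈-refl au∈a)

    -- The order of a divides that of u: if uᵏ = e then (a u)ᵏ = aᵏ lies in ⟨a⟩ ∩ ⟨a u⟩.
    ^≡e-transfer : ∀ {u} → ¬ (u ∈⟨ a ⟩) → Commute a u → ∀ k → u ^ k ≡ e → a ^ k ≡ e
    ^≡e-transfer {u} u∉a au k uᵏ≡e = indep (a∙-∉ u∉a) (k , refl) (k , (begin
      (a ∙ u) ^ k      ≡⟨ ∙-^ au k ⟩
      a ^ k ∙ u ^ k    ≡⟨ cong (a ^ k ∙_) uᵏ≡e ⟩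
      a ^ k ∙ e        ≡⟨ identityʳ _ ⟩
      a ^ k            ∎))

    module _ {b} (b-max : MaximalCyclic b) (b∉a : ¬ (b ∈⟨ a ⟩)) where

      -- The trivial subgroup lies in ⟨b⟩, so a trivial ⟨a⟩ could be maximal only if it contained b.
      a≢e : a ≢ e
      a≢e a≡e = b∉a (maximal-∈ a-max (subst (_∈⟨ b ⟩) (sym a≡e) e∈))

      -- Write u = cˢ, v = cᵗ with s = p d, t = q d and p, q coprime: then u^q = v^p, and if this
      -- were e then a^p = a^q = e, so a = e by Bézout.
      common-power : ∀ {c u v} → u ∈⟨ c ⟩ → v ∈⟨ c ⟩ → ¬ (u ∈⟨ a ⟩) → ¬ (v ∈⟨ a ⟩) →
                     Commute a u → Commute a v → ∃ λ w → w ≢ e × w ∈⟨ u ⟩ × w ∈⟨ v ⟩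
      common-power {c} {u} {v} (s , refl) (t , refl) u∉a v∉a au av
        with Bézout.lemma s t
      ... | Bézout.result d gcd bézout
        with GCD.commonDivisor gcd
      ... | divides p refl , divides q refl
        = u ^ q , u^q≢e , (q , refl) , (p , sym u^q≡v^p)
        where
          u^q≡v^p : u ^ q ≡ v ^ p
          u^q≡v^p = begin
            (c ^ (p * d)) ^ q   ≡⟨ ^-* c q (p * d) ⟨
            c ^ (q * (p * d))   ≡⟨ cong (c ^_) (*-assoc q p d) ⟨
            c ^ (q * p * d)     ≡⟨ cong (λ r → c ^ (r * d)) (*-comm q p) ⟩
            c ^ (p * q * d)     ≡⟨ cong (c ^_) (*-assoc p q d) ⟩
            c ^ (p * (q * d))   ≡⟨ ^-* c p (q * d) ⟩
            (c ^ (q * d)) ^ p   ∎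

          -- For d = 0 the element u would be c⁰ = e, which lies in ⟨a⟩. Hence d can be cancelled
          -- from the Bézout identity.
          d≢0 : d ≢ 0
          d≢0 refl = u∉a (subst (_∈⟨ a ⟩) (cong (c ^_) (*-comm 0 p)) e∈)

          a≡e-from : ∀ p q x y → d + y * (q * d) ≡ x * (p * d) → a ^ p ≡ e → a ^ q ≡ e → a ≡ e
          a≡e-from p q x y eq aᵖ≡e a^q≡e = begin
            a                    ≡⟨ identityʳ a ⟨
            a ∙ e                ≡⟨ cong (a ∙_) (^-*≡e a y a^q≡e) ⟨
            a ^ (1 + y * q)      ≡⟨ cong (a ^_) (*-cancelʳ-≡ (1 + y * q) (x * p) d {{≢-nonZero d≢0}}
                                      (trans (cong (d +_) (*-assoc y q d)) (trans eq (sym (*-assoc x p d))))) ⟩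
            a ^ (x * p)          ≡⟨ ^-*≡e a x aᵖ≡e ⟩
            e                    ∎

          u^q≢e : u ^ q ≢ e
          u^q≢e u^q≡e = a≢e (conclude bézout)
            where
              a^q≡e = ^≡e-transfer u∉a au q u^q≡e
              a^p≡e = ^≡e-transfer v∉a av p (trans (sym u^q≡v^p) u^q≡e)
              conclude : Bézout.Identity d (p * d) (q * d) → a ≡ e
              conclude (Bézout.+- x y eq) = a≡e-from p q x y eq a^p≡e a^q≡e
              conclude (Bézout.-+ x y eq) = a≡e-from q p y x eq a^q≡e a^p≡e

      -- By `^≡e-transfer` the order n of a divides the order N of w. With N = t n, the power wᵗ has
      -- order n, and every exponent killing a is a multiple of n.
      ∃-power-killed-by-order : ∀ {w} → ¬ (w ∈⟨ a ⟩) → Commute a w →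
                                ∃ λ u → u ∈⟨ w ⟩ × u ≢ e × (∀ k → a ^ k ≡ e → u ^ k ≡ e)
      ∃-power-killed-by-order {w} w∉a aw
        with order-∣ _ (^≡e-transfer w∉a aw (suc (Order.n-1 (orderOf w))) (Order.^-order (orderOf w)))
        where open Order (orderOf a)
      ... | divides t N≡t*n = w ^ t , (t , refl) , wᵗ≢e , killed
        where
          open Order (orderOf a)
          module W = Order (orderOf w)
          order≡1⇒a≡e : n-1 ≡ 0 → a ≡ e
          order≡1⇒a≡e eq = trans (sym (identityʳ a)) (subst (λ k → a ^ suc k ≡ e) eq ^-order)

          wᵗ≢e : w ^ t ≢ e
          -- Otherwise t = r N, so N = t n = r n N; cancelling N gives n = 1 and a = e.
          wᵗ≢e wᵗ≡e with W.order-∣ t wᵗ≡e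
          ... | divides r t≡r*N = a≢e (order≡1⇒a≡e (suc-injective (m*n≡1⇒n≡1 r (suc n-1)
                  (*-cancelʳ-≡ (r * suc n-1) 1 (suc W.n-1) (begin
                    r * suc n-1 * suc W.n-1     ≡⟨ *-assoc r _ _ ⟩
                    r * (suc n-1 * suc W.n-1)   ≡⟨ cong (r *_) (*-comm (suc n-1) _) ⟩
                    r * (suc W.n-1 * suc n-1)   ≡⟨ *-assoc r _ _ ⟨
                    r * suc W.n-1 * suc n-1     ≡⟨ cong (_* suc n-1) t≡r*N ⟨
                    t * suc n-1                 ≡⟨ N≡t*n ⟨
                    suc W.n-1                   ≡⟨ *-identityˡ _ ⟨
                    1 * suc W.n-1               ∎)))))

          killed : ∀ k → a ^ k ≡ e → (w ^ t) ^ k ≡ e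
          killed k aᵏ≡e with order-∣ k aᵏ≡e
          ... | divides r refl = ^-*≡e (w ^ t) r (begin
            (w ^ t) ^ suc n-1     ≡⟨ ^-* w (suc n-1) t ⟨
            w ^ (suc n-1 * t)     ≡⟨ cong (w ^_) (trans (*-comm (suc n-1) t) (sym N≡t*n)) ⟩
            w ^ suc W.n-1         ≡⟨ W.^-order ⟩
            e                     ∎)

      -- Contradiction from nontrivial intersections

      module _ (meet : ∀ {c d} → MaximalCyclic c → MaximalCyclic d → ¬ (c ∈⟨ a ⟩) → ¬ (d ∈⟨ a ⟩) →
                       ∃ λ w → w ≢ e × w ∈⟨ c ⟩ × w ∈⟨ d ⟩) where

        -- A nontrivial common element of ⟨y a y⁻¹⟩ and ⟨b⟩ commutes with y, hence lies in ⟨a⟩ ∩ ⟨b⟩.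
        ⟨b⟩-normalises-⟨a⟩ : ∀ {y} → y ∈⟨ b ⟩ → conj y a ∈⟨ a ⟩
        ⟨b⟩-normalises-⟨a⟩ {y} y∈b = decidable-stable (conj y a ∈?⟨ a ⟩) λ a'∉a →
          let w , w≢e , w∈a' , w∈b = meet (conj-maximal y a-max) b-max a'∉a b∉a
              w∈a = subst₂ _∈⟨_⟩ (commute⇒conj≡ (∈-commute (∈-⁻¹ y∈b) w∈b)) (conj-⁻¹-conj y a)
                      (conj-∈ (y ⁻¹) w∈a')
          in w≢e (indep b∉a w∈a w∈b)

        -- For a common element a y a⁻¹ of ⟨a b a⁻¹⟩ and ⟨b⟩, the commutator
        -- a y a⁻¹ y⁻¹ lies in ⟨a⟩ ∩ ⟨b⟩.
        ∃-commuting : ∃ λ w → w ≢ e × w ∈⟨ b ⟩ × Commute a w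
        ∃-commuting with meet (conj-maximal a b-max) b-max b'∉a b∉a
          where
            b'∉a : ¬ (conj a b ∈⟨ a ⟩)
            b'∉a b'∈a = b∉a (∈-cancelˡ ∈-refl (∈-cancelʳ ⁻¹∈ b'∈a))
        ... | _ , w≢e , (k , refl) , w∈b = y , y≢e , (k , refl) , conj≡⇒commute aya⁻¹≡y
          where
            y = b ^ k
            y∈b : y ∈⟨ b ⟩
            y∈b = k , refl
            aya⁻¹∈b : conj a y ∈⟨ b ⟩
            aya⁻¹∈b = subst (_∈⟨ b ⟩) (conj-^ a b k) w∈b
            -- Rebracketed as a (y a⁻¹ y⁻¹), whose second factor is in ⟨a⟩ because y normalises it.
            commutator∈a : conj a y ∙ y ⁻¹ ∈⟨ a ⟩
            commutator∈a = subst (_∈⟨ a ⟩)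
              (begin
                a ∙ ((y ∙ a ⁻¹) ∙ y ⁻¹)     ≡⟨ assoc a _ _ ⟨
                (a ∙ (y ∙ a ⁻¹)) ∙ y ⁻¹     ≡⟨ cong (_∙ y ⁻¹) (assoc a y _) ⟨
                conj a y ∙ y ⁻¹             ∎)
              (∈-∙ ∈-refl (∈-trans (conj-∈ y ⁻¹∈) (⟨b⟩-normalises-⟨a⟩ y∈b)))
            aya⁻¹≡y : conj a y ≡ y
            aya⁻¹≡y = x∙y⁻¹≈ε⇒x≈y _ _ (indep b∉a commutator∈a (∈-∙ aya⁻¹∈b (∈-⁻¹ y∈b)))
            y≢e : y ≢ e
            y≢e y≡e = w≢e (trans (conj-^ a b k) (trans aya⁻¹≡y y≡e))

        meet-impossible : ⊥
        meet-impossible with ∃-commuting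
        ... | w , w≢e , w∈b , aw with ∃-power-killed-by-order (∉⟨a⟩ b∉a w∈b w≢e) aw
        ... | u , u∈w , u≢e , killed with maximalCyclic-above (a ∙ u)
        ... | c , c-max , au∈c = v₂≢e v₂≡e
          where
            u∈b = ∈-trans u∈w w∈b
            u∉a = ∉⟨a⟩ b∉a u∈b u≢e
            c∉a : ¬ (c ∈⟨ a ⟩)
            c∉a c∈a = a∙-∉ u∉a (∈-trans au∈c c∈a)
            a-u : Commute a u
            a-u = commute-∈ aw u∈w
            v-data = meet b-max c-max b∉a c∉a
            v = proj₁ v-data
            v≢e = proj₁ (proj₂ v-data)
            v∈b = proj₁ (proj₂ (proj₂ v-data))
            v∈c = proj₂ (proj₂ (proj₂ v-data))
            a-v : Commute a v
            -- Only a left factor can be cancelled, so a u is first rewritten as u a.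
            a-v = sym (commute-cancelˡ (∈-commute v∈b u∈b)
                    (subst (Commute v) a-u (∈-commute v∈c au∈c)))
            -- Common powers are taken twice: first of u and v inside ⟨b⟩, then of the result v₁ and
            -- a u inside ⟨c⟩. The final v₂ lies in both ⟨u⟩ and ⟨a u⟩.
            v₁-data = common-power u∈b v∈b u∉a (∉⟨a⟩ b∉a v∈b v≢e) a-u a-v
            v₁ = proj₁ v₁-data
            v₁≢e = proj₁ (proj₂ v₁-data)
            v₁∈u = proj₁ (proj₂ (proj₂ v₁-data))
            v₁∈v = proj₂ (proj₂ (proj₂ v₁-data))
            v₂-data = common-power (∈-trans v₁∈v v∈c) au∈c
                        (∉⟨a⟩ b∉a (∈-trans v₁∈v v∈b) v₁≢e) (a∙-∉ u∉a)
                        (commute-∈ a-v v₁∈v) (commute-∙ refl a-u)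
            v₂ = proj₁ v₂-data
            v₂≢e = proj₁ (proj₂ v₂-data)
            v₂∈u = ∈-trans (proj₁ (proj₂ (proj₂ v₂-data))) v₁∈u
            q = proj₁ (proj₂ (proj₂ (proj₂ v₂-data)))
            v₂≡ : a ^ q ∙ u ^ q ≡ v₂
            v₂≡ = trans (sym (∙-^ a-u q)) (proj₂ (proj₂ (proj₂ (proj₂ v₂-data))))
            -- Both a^q u^q = v₂ and u^q lie in ⟨u⟩, so a^q does too, and independence makes it
            -- trivial.
            a^q≡e : a ^ q ≡ e
            a^q≡e = indep u∉a (q , refl)
                      (∈-cancelʳ (q , refl) (subst (_∈⟨ u ⟩) (sym v₂≡) v₂∈u))
            v₂≡e : v₂ ≡ e
            v₂≡e = trans (sym v₂≡) (trans (cong₂ _∙_ a^q≡e (killed q a^q≡e)) (identityˡ e))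

  -- Essential sets: awnings and colourings with few colours

  module EssentialSet
    {m} {xs : Fin m → Carrier} (essential : EssentialCyclicSet m xs)
    {i₀} (i₀-independent : InICS xs i₀) {i₁} (i₁≢i₀ : i₁ ≢ i₀)
    where

    open EssentialCyclicSet essential

    a : Carrier
    a = xs i₀

    xs-∉ : ∀ {i j} → i ≢ j → ¬ (xs i ∈⟨ xs j ⟩)
    xs-∉ {i} {j} i≢j xᵢ∈xⱼ = distinct i j i≢j (∈⇒⊆ xᵢ∈xⱼ , maximal i (xs j) (∈⇒⊆ xᵢ∈xⱼ))

    indep-max : ∀ {c} → MaximalCyclic c → ¬ (c ∈⟨ a ⟩) → ∀ {g} → g ∈⟨ a ⟩ → g ∈⟨ c ⟩ → g ≡ e
    indep-max {c} c-max c∉a g∈a g∈c with covers c c-max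
    ... | k , c⊆xₖ , _ = i₀-independent k (λ { refl → c∉a (⊆⇒∈ c⊆xₖ) }) _ g∈a (c⊆xₖ _ g∈c)

    open IndependentCyclic (maximal i₀) indep-max

    i₁∉a : ¬ (xs i₁ ∈⟨ a ⟩)
    i₁∉a = xs-∉ i₁≢i₀

    xs-i₀≢e : a ≢ e
    xs-i₀≢e = a≢e (maximal i₁) i₁∉a

    xs-≢e : ∀ i → xs i ≢ e
    xs-≢e i xᵢ≡e with i ≟ i₀
    ... | yes refl = xs-i₀≢e xᵢ≡e
    ... | no i≢i₀  = xs-∉ i≢i₀ (subst (_∈⟨ a ⟩) (sym xᵢ≡e) e∈)

    Meet : Set
    Meet = ∀ {i j} → i ≢ i₀ → j ≢ i₀ → i ≢ j → ∃ λ w → w ≢ e × w ∈⟨ xs i ⟩ × w ∈⟨ xs j ⟩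

    -- `meet-impossible` asks about arbitrary maximal generators, conjugates included, so `covers`
    -- replaces them by members of the set. If both go to the same member, that member itself is the
    -- common element.
    ¬Meet : ¬ Meet
    ¬Meet meet = meet-impossible (maximal i₁) i₁∉a meet-max
      where
        meet-max : ∀ {c d} → MaximalCyclic c → MaximalCyclic d → ¬ (c ∈⟨ a ⟩) → ¬ (d ∈⟨ a ⟩) →
                   ∃ λ w → w ≢ e × w ∈⟨ c ⟩ × w ∈⟨ d ⟩
        meet-max {c} {d} c-max d-max c∉a d∉a with covers c c-max | covers d d-max
        ... | i , c⊆xᵢ , xᵢ⊆c | j , d⊆xⱼ , xⱼ⊆d with i ≟ j
        ...   | yes refl = xs i , xs-≢e i , ⊆⇒∈ xᵢ⊆c , ⊆⇒∈ xⱼ⊆d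
        ...   | no i≢j =
          let w , w≢e , w∈xᵢ , w∈xⱼ = meet (λ { refl → c∉a (⊆⇒∈ c⊆xᵢ) }) (λ { refl → d∉a (⊆⇒∈ d⊆xⱼ) }) i≢j
          in w , w≢e , xᵢ⊆c w w∈xᵢ , xⱼ⊆d w w∈xⱼ

    -- Comparing h_{i,j} with h_{j,l} forces e to change class between i and j, while comparing
    -- h_{i,l} with h_{j,l} forces it to keep its class.
    awning-triple : ∀ {ys : Fin m → Carrier} {h inA} → Awning ys h inA → ∀ {i j l} → i <ᶠ j → j <ᶠ l →
                    h i j ≡ e → h i l ≡ e → h j l ≡ e → ⊥
    awning-triple {h = h} {inA} awning {i} {j} {l} i<j j<l ij il jl
      with inA i (h i j) in inAᵢ
    ... | true  = contradiction (trans (sym (cond2c i j l l i<j j<l i<l (trans jl (sym il)) refl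
                                  (trans (cong (inA i) (trans il (sym ij))) inAᵢ)))
                                (cond2a i j l j i<j j<l i<j (trans jl (sym ij)) refl inAᵢ)) λ ()
      where open Awning awning
            i<l = <ᶠ-trans i<j j<l
    ... | false = contradiction (trans (sym (cond2d i j l l i<j j<l i<l (trans jl (sym il)) refl
                                  (trans (cong (inA i) (trans il (sym ij))) inAᵢ)))
                                (cond2b i j l j i<j j<l i<j (trans jl (sym ij)) refl inAᵢ)) λ ()
      where open Awning awning
            i<l = <ᶠ-trans i<j j<l

    -- The common element is the awning entry at the positions of the two members, the earlier
    -- position coming first.
    awning⇒Meet : HasAwning xs → Meet
    awning⇒Meet (σ , h , inA , awning) {i} {j} i≢i₀ j≢i₀ i≢j = meets (<ᶠ-cmp (σ ⟨$⟩ˡ i) (σ ⟨$⟩ˡ j))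
      where
        open Awning awning
        -- `σ` sends positions to indices of `xs`, so this is the place of a in the ordering.
        p₀ = σ ⟨$⟩ˡ i₀

        σˡ-≢ : ∀ {i j} → i ≢ j → σ ⟨$⟩ˡ i ≢ σ ⟨$⟩ˡ j
        σˡ-≢ i≢j eq = i≢j (trans (sym (inverseʳ σ)) (trans (cong (σ ⟨$⟩ʳ_) eq) (inverseʳ σ)))

        common-with-a : ∀ {p g} → p ≢ p₀ → g ∈⟨ xs (σ ⟨$⟩ʳ p) ⟩ → g ∈⟨ xs (σ ⟨$⟩ʳ p₀) ⟩ → g ≡ e
        common-with-a {p} {g} p≢p₀ g∈p g∈p₀ = i₀-independent (σ ⟨$⟩ʳ p)
          (λ eq → p≢p₀ (trans (sym (inverseˡ-perm σ)) (cong (σ ⟨$⟩ˡ_) eq))) g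
          (subst (λ i → g ∈⟨ xs i ⟩) (inverseʳ σ) g∈p₀) g∈p

        h-p₀ : ∀ {p} → p ≢ p₀ → p <ᶠ p₀ → h p p₀ ≡ e
        h-p₀ p≢p₀ p<p₀ = common-with-a p≢p₀ (proj₁ (cond1 _ _ p<p₀)) (proj₂ (cond1 _ _ p<p₀))

        p₀-h : ∀ {p} → p ≢ p₀ → p₀ <ᶠ p → h p₀ p ≡ e
        p₀-h p≢p₀ p₀<p = common-with-a p≢p₀ (proj₂ (cond1 _ _ p₀<p)) (proj₁ (cond1 _ _ p₀<p))

        -- Inserting p₀ among p < q would give a triple on which h is constantly e.
        h≢e : ∀ {p q} → p <ᶠ q → p ≢ p₀ → q ≢ p₀ → h p q ≢ e
        h≢e {p} {q} p<q p≢p₀ q≢p₀ hpq≡e with <ᶠ-cmp p p₀ | <ᶠ-cmp q p₀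
        ... | tri≈ _ p≡p₀ _ | _ = p≢p₀ p≡p₀
        ... | _ | tri≈ _ q≡p₀ _ = q≢p₀ q≡p₀
        ... | tri< p<p₀ _ _ | tri< q<p₀ _ _ =
          awning-triple awning p<q q<p₀ hpq≡e (h-p₀ p≢p₀ p<p₀) (h-p₀ q≢p₀ q<p₀)
        ... | tri< p<p₀ _ _ | tri> _ _ p₀<q =
          awning-triple awning p<p₀ p₀<q (h-p₀ p≢p₀ p<p₀) hpq≡e (p₀-h q≢p₀ p₀<q)
        ... | tri> _ _ p₀<p | tri< q<p₀ _ _ = <ᶠ-asym p<q (<ᶠ-trans q<p₀ p₀<p)
        ... | tri> _ _ p₀<p | tri> _ _ p₀<q =
          awning-triple awning p₀<p p<q (p₀-h p≢p₀ p₀<p) (p₀-h q≢p₀ p₀<q) hpq≡e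

        cond1-xs : ∀ {i j} → (σ ⟨$⟩ˡ i) <ᶠ (σ ⟨$⟩ˡ j) →
                   let g = h (σ ⟨$⟩ˡ i) (σ ⟨$⟩ˡ j) in g ∈⟨ xs i ⟩ × g ∈⟨ xs j ⟩
        cond1-xs {i} {j} p<q = subst₂ (λ i' j' → let g = h (σ ⟨$⟩ˡ i) (σ ⟨$⟩ˡ j) in g ∈⟨ xs i' ⟩ × g ∈⟨ xs j' ⟩)
                                      (inverseʳ σ) (inverseʳ σ) (cond1 _ _ p<q)

        meets : Tri _ _ _ → ∃ λ w → w ≢ e × w ∈⟨ xs i ⟩ × w ∈⟨ xs j ⟩
        meets (tri< p<q _ _) = _ , h≢e p<q (σˡ-≢ i≢i₀) (σˡ-≢ j≢i₀) , cond1-xs p<q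
        meets (tri≈ _ p≡q _) = contradiction p≡q (σˡ-≢ i≢j)
        meets (tri> _ _ q<p) = _ , h≢e q<p (σˡ-≢ j≢i₀) (σˡ-≢ i≢i₀) , swap (cond1-xs q<p)

    -- Two members are joined by a two-edge path whose midpoint lies in both subgroups. If one of
    -- them is a, the midpoint is e, so the edge from e to a differs in colour from the edge to any
    -- other member. Were e also the midpoint between two other members, three colours would occur
    -- at e.
    few-colours⇒Meet : ∀ {k} → k < 3 → RainbowColourable EPAdj k → Meet
    few-colours⇒Meet k<3 (ζ , rainbow) {i} {j} i≢i₀ j≢i₀ i≢j = meets
      where
        open EdgeColouring ζ
        open RainbowPaths ζ

        common : ∀ {i j} → i ≢ j → ∃ λ p → p ∈⟨ xs i ⟩ × p ∈⟨ xs j ⟩ × col (xs i) p ≢ col p (xs j)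
        common {i} {j} i≢j =
          let p , (_ , z , xᵢ∈z , p∈z) , (_ , z' , p∈z' , xⱼ∈z') , c≢ =
                rainbow-midpoint k<3 xᵢ≢xⱼ ¬adj (rainbow (xs i) (xs j) xᵢ≢xⱼ)
          -- By maximality a cyclic subgroup containing a member lies inside the subgroup of that
          -- member.
          in p , ∈-trans p∈z (maximal-∈ (maximal i) xᵢ∈z)
               , ∈-trans p∈z' (maximal-∈ (maximal j) xⱼ∈z') , c≢
          where
            xᵢ≢xⱼ : xs i ≢ xs j
            xᵢ≢xⱼ eq = xs-∉ i≢j (subst (_∈⟨ xs j ⟩) (sym eq) ∈-refl)
            ¬adj : ¬ EPAdj (xs i) (xs j)
            ¬adj (_ , z , xᵢ∈z , xⱼ∈z) = xs-∉ i≢j (∈-trans xᵢ∈z (maximal-∈ (maximal j) xⱼ∈z))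

        spoke : Fin m → _
        spoke i = col (xs i) e

        spoke-≢₀ : ∀ {i} → i ≢ i₀ → spoke i ≢ spoke i₀
        spoke-≢₀ i≢i₀ with common i≢i₀
        ... | p , p∈xᵢ , p∈a , c≢ with i₀-independent _ i≢i₀ p p∈a p∈xᵢ
        ...   | refl = λ eq → c≢ (trans eq (symm _ _))

        meets : ∃ λ w → w ≢ e × w ∈⟨ xs i ⟩ × w ∈⟨ xs j ⟩
        meets with common i≢j
        ... | p , p∈xᵢ , p∈xⱼ , c≢ = p , p≢e , p∈xᵢ , p∈xⱼ
          where
            p≢e : p ≢ e
            p≢e refl = <⇒≱ k<3 (distinct-triple⇒3≤ (λ eq → c≢ (trans eq (symm _ _)))
                                  (spoke-≢₀ i≢i₀) (spoke-≢₀ j≢i₀))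

    -- A rainbow 3-colouring

    module _ (i₀-unique : ∀ j → InICS xs j → j ≡ i₀) where

      -- If b² = e then ⟨b⟩ = {e, b}, and b lies in no other member's subgroup, which would make b a
      -- second independent member.
      xs-not-involution : ∀ {i} → i ≢ i₀ → xs i ≢ xs i ⁻¹
      xs-not-involution {i} i≢i₀ b≡b⁻¹ = i≢i₀ (i₀-unique i λ j j≢i g g∈b g∈xⱼ → ind j≢i g∈xⱼ (trivial-or-generator g∈b))
        where
          b = xs i
          bb≡e : b ∙ b ≡ e
          bb≡e = trans (cong (b ∙_) b≡b⁻¹) (∙-inverseʳ b)
          power : ∀ k → b ^ k ≡ e ⊎ b ^ k ≡ b
          power zero = inj₁ refl
          power (suc k) with power k
          ... | inj₁ eq = inj₂ (trans (cong (b ∙_) eq) (identityʳ b))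
          ... | inj₂ eq = inj₁ (trans (cong (b ∙_) eq) bb≡e)
          trivial-or-generator : ∀ {g} → g ∈⟨ b ⟩ → g ≡ e ⊎ g ≡ b
          trivial-or-generator (k , refl) = power k
          ind : ∀ {j g} → j ≢ i → g ∈⟨ xs j ⟩ → g ≡ e ⊎ g ≡ b → g ≡ e
          ind j≢i g∈xⱼ (inj₁ g≡e)  = g≡e
          ind j≢i g∈xⱼ (inj₂ refl) = contradiction g∈xⱼ (xs-∉ (j≢i ∘ sym))

      -- The order on `Fin order` is an arbitrary device for telling x from x⁻¹. Involutions outside
      -- ⟨a⟩ all get 2.
      spoke : Carrier → Fin 3
      spoke x with x ∈?⟨ a ⟩ | x <? x ⁻¹
      ... | yes _ | _     = 0F
      ... | no _  | yes _ = 1F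
      ... | no _  | no _  = 2F

      spoke-∈ : ∀ {x} → x ∈⟨ a ⟩ → spoke x ≡ 0F
      spoke-∈ {x} x∈a with x ∈?⟨ a ⟩ | x <? x ⁻¹
      ... | yes _  | _ = refl
      ... | no x∉a | _ = contradiction x∈a x∉a

      spoke-∉ : ∀ {x} → ¬ (x ∈⟨ a ⟩) → spoke x ≢ 0F
      spoke-∉ {x} x∉a with x ∈?⟨ a ⟩ | x <? x ⁻¹
      ... | yes x∈a | _     = contradiction x∈a x∉a
      ... | no _    | yes _ = λ ()
      ... | no _    | no _  = λ ()

      spoke-⁻¹ : ∀ {x} → ¬ (x ∈⟨ a ⟩) → x ≢ x ⁻¹ → spoke x ≢ spoke (x ⁻¹)
      spoke-⁻¹ {x} x∉a x≢x⁻¹ with x ∈?⟨ a ⟩ | x <? x ⁻¹ | x ⁻¹ ∈?⟨ a ⟩ | x ⁻¹ <? x ⁻¹ ⁻¹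
      ... | yes x∈a | _ | _ | _ = contradiction x∈a x∉a
      ... | no _ | _ | yes x⁻¹∈a | _ = contradiction (∈-⁻¹⁻ x⁻¹∈a) x∉a
      ... | no _ | yes x<x⁻¹ | no _ | yes x⁻¹<x =
        contradiction (subst (x ⁻¹ <ᶠ_) (⁻¹-involutive x) x⁻¹<x) (<ᶠ-asym x<x⁻¹)
      ... | no _ | yes _ | no _ | no _  = λ ()
      ... | no _ | no _  | no _ | yes _ = λ ()
      ... | no _ | no x≮x⁻¹ | no _ | no x⁻¹≮x with <ᶠ-cmp x (x ⁻¹)
      ...   | tri< x<x⁻¹ _ _ = contradiction x<x⁻¹ x≮x⁻¹
      ...   | tri≈ _ x≡x⁻¹ _ = contradiction x≡x⁻¹ x≢x⁻¹
      ...   | tri> _ _ x⁻¹<x = contradiction (subst (x ⁻¹ <ᶠ_) (sym (⁻¹-involutive x)) x⁻¹<x) x⁻¹≮x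

      -- An involution outside ⟨a⟩ lies in some ⟨b⟩ with b² ≠ e, and is adjacent to both b and b⁻¹.
      opposite-neighbour : ∀ {x} → ¬ (x ∈⟨ a ⟩) →
                           ∃ λ y → EPAdj x y × ¬ (y ∈⟨ a ⟩) × spoke x ≢ spoke y
      opposite-neighbour {x} x∉a with x ≟ x ⁻¹
      ... | no x≢x⁻¹ = x ⁻¹ , (x≢x⁻¹ , x , ∈-refl , ⁻¹∈) , x∉a ∘ ∈-⁻¹⁻ , spoke-⁻¹ x∉a x≢x⁻¹
      ... | yes x≡x⁻¹ with maximalCyclic-above x
      ...   | c , c-max , x∈c with covers c c-max
      ...     | i , c⊆b , _ = choose (spoke x ≟ spoke b)
        where
          b = xs i
          x∈b : x ∈⟨ b ⟩
          x∈b = c⊆b x x∈c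
          i≢i₀ : i ≢ i₀
          i≢i₀ refl = x∉a x∈b
          b∉a = xs-∉ i≢i₀
          b≢b⁻¹ = xs-not-involution i≢i₀
          x≢b : x ≢ b
          x≢b refl = b≢b⁻¹ x≡x⁻¹
          x≢b⁻¹ : x ≢ b ⁻¹
          x≢b⁻¹ x≡b⁻¹ = x≢b (⁻¹-injective (trans (sym x≡x⁻¹) x≡b⁻¹))
          -- Since b and b⁻¹ have opposite classes, x differs in class from at least one of them.
          choose : Dec (spoke x ≡ spoke b) → ∃ λ y → EPAdj x y × ¬ (y ∈⟨ a ⟩) × spoke x ≢ spoke y
          choose (no ≢b) = b , (x≢b , b , x∈b , ∈-refl) , b∉a , ≢b
          choose (yes ≡b) = b ⁻¹ , (x≢b⁻¹ , b , x∈b , ⁻¹∈) , b∉a ∘ ∈-⁻¹⁻ ,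
                            λ ≡b⁻¹ → spoke-⁻¹ b∉a b≢b⁻¹ (trans (sym ≡b) ≡b⁻¹)

      colour : Carrier → Carrier → Fin 3
      colour x y with x ≟ e | y ≟ e
      ... | yes _ | _     = spoke y
      ... | no _  | yes _ = spoke x
      ... | no _  | no _  = 0F

      colour-sym : ∀ x y → colour x y ≡ colour y x
      colour-sym x y with x ≟ e | y ≟ e
      ... | yes refl | yes refl = refl
      ... | yes _    | no _     = refl
      ... | no _     | yes _    = refl
      ... | no _     | no _     = refl

      colour-eʳ : ∀ {x} → x ≢ e → colour x e ≡ spoke x
      colour-eʳ {x} x≢e with x ≟ e | e ≟ e
      ... | yes x≡e | _      = contradiction x≡e x≢e
      ... | no _    | yes _  = refl
      ... | no _    | no e≢e = contradiction refl e≢e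

      colour-eˡ : ∀ {x} → x ≢ e → colour e x ≡ spoke x
      colour-eˡ x≢e = trans (colour-sym e _) (colour-eʳ x≢e)

      colour-≢e : ∀ {x y} → x ≢ e → y ≢ e → colour x y ≡ 0F
      colour-≢e {x} {y} x≢e y≢e with x ≟ e | y ≟ e
      ... | yes x≡e | _       = contradiction x≡e x≢e
      ... | no _    | yes y≡e = contradiction y≡e y≢e
      ... | no _    | no _    = refl

      ζ : EdgeColouring EPAdj 3
      ζ = record { col = colour ; symm = colour-sym }

      open RainbowPaths ζ

      adj-eʳ : ∀ {x} → x ≢ e → EPAdj x e
      adj-eʳ {x} x≢e = x≢e , x , ∈-refl , e∈

      adj-eˡ : ∀ {x} → x ≢ e → EPAdj e x
      adj-eˡ {x} x≢e = x≢e ∘ sym , x , e∈ , ∈-refl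

      ∉⇒≢e : ∀ {x} → ¬ (x ∈⟨ a ⟩) → x ≢ e
      ∉⇒≢e x∉a refl = x∉a e∈

      path-via-e : ∀ {x y} → x ≢ y → x ≢ e → y ≢ e → spoke x ≢ spoke y → RainbowPath EPAdj ζ x y
      path-via-e x≢y x≢e y≢e s≢ = path₂ x≢e x≢y (y≢e ∘ sym) (adj-eʳ x≢e) (adj-eˡ y≢e)
        λ eq → s≢ (trans (sym (colour-eʳ x≢e)) (trans eq (colour-eˡ y≢e)))

      path-outside : ∀ {x y} → x ≢ y → ¬ (x ∈⟨ a ⟩) → ¬ (y ∈⟨ a ⟩) → RainbowPath EPAdj ζ x y
      path-outside {x} {y} x≢y x∉a y∉a with spoke x ≟ spoke y
      ... | no s≢ = path-via-e x≢y (∉⇒≢e x∉a) (∉⇒≢e y∉a) s≢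
      ... | yes sx≡sy with opposite-neighbour x∉a
      ...   | x' , adj@(x≢x' , _) , x'∉a , sx≢sx' =
        -- The colours along x, x', e, y are 0, `spoke x'` and `spoke y`: the last two are nonzero
        -- outside ⟨a⟩, and they differ because `spoke y` equals `spoke x`.
        path₃ x≢x' x≢e x≢y x'≢e (λ { refl → sx≢sx' sx≡sy }) (y≢e ∘ sym)
          adj (adj-eʳ x'≢e) (adj-eˡ y≢e)
          (λ eq → spoke-∉ x'∉a (trans (sym (colour-eʳ x'≢e)) (trans (sym eq) (colour-≢e x≢e x'≢e))))
          (λ eq → spoke-∉ y∉a (trans (sym (colour-eˡ y≢e)) (trans (sym eq) (colour-≢e x≢e x'≢e))))
          (λ eq → sx≢sx' (trans sx≡sy (trans (sym (colour-eˡ y≢e)) (trans (sym eq) (colour-eʳ x'≢e)))))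
        where
          x≢e  = ∉⇒≢e x∉a
          y≢e  = ∉⇒≢e y∉a
          x'≢e = ∉⇒≢e x'∉a

      -- Pairs containing e or inside ⟨a⟩ are adjacent. A pair with one element in ⟨a⟩ is joined
      -- through e by colour 0 and a nonzero colour.
      ζ-rainbow : IsRainbowColouring EPAdj ζ
      ζ-rainbow x y x≢y with x ≟ e | y ≟ e
      ... | yes refl | _        = path₁ x≢y (adj-eˡ (x≢y ∘ sym))
      ... | no x≢e   | yes refl = path₁ x≢y (adj-eʳ x≢e)
      ... | no x≢e   | no y≢e with x ∈?⟨ a ⟩ | y ∈?⟨ a ⟩
      ...   | yes x∈a | yes y∈a = path₁ x≢y (x≢y , a , x∈a , y∈a)
      ...   | yes x∈a | no y∉a  = path-via-e x≢y x≢e y≢e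
        λ eq → spoke-∉ y∉a (trans (sym eq) (spoke-∈ x∈a))
      ...   | no x∉a  | yes y∈a = path-via-e x≢y x≢e y≢e
        λ eq → spoke-∉ x∉a (trans eq (spoke-∈ y∈a))
      ...   | no x∉a  | no y∉a  = path-outside x≢y x∉a y∉a

-- The equivalence

other-index : ∀ {m} → 3 ≤ m → (i : Fin m) → ∃ λ j → j ≢ i
other-index (s≤s (s≤s _)) fzero    = 1F , λ ()
other-index (s≤s (s≤s _)) (fsuc _) = 0F , λ ()

theorem3p3 : (G : FiniteGroup) (m : ℕ) (xs : Fin m → FiniteGroup.Carrier G) →
    FiniteGroup.EssentialCyclicSet G m xs → 3 ≤ m → FiniteGroup.ICN≡1 G xs →
    RC≡ (FiniteGroup.EPAdj G) 3 ⇔ (¬ FiniteGroup.HasAwning G xs)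
theorem3p3 G m xs essential 3≤m (i₀ , i₀-independent , i₀-unique) = mk⇔
  (λ _ → ¬Meet ∘ awning⇒Meet)
  (λ _ → (ζ i₀-unique , ζ-rainbow i₀-unique) , λ j j<3 → ¬Meet ∘ few-colours⇒Meet j<3)
  where
    open CyclicSubgroups G
    -- A second index, available as m ≥ 3, gives the member outside ⟨a⟩ that plays the role of b.
    open EssentialSet essential i₀-independent (proj₂ (other-index 3≤m i₀))
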